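{- Let $t$ be a PPC_dB term (well-formed, so that $\mathcal U(t)$ is defined). If $t\to_{dB}t'$, then $\mathcal U(t)\to_{PPC}\mathcal U(t')$.
   Context: **PPC.** Fix a countably infinite set of symbols. Terms: $t::=x\mid\hat x\mid t\,t\mid\lambda_\theta p.s$, where $\theta$ is a list of symbols binding the matchables $\hat x$ ($x\in\theta$) in $p$ and the variables $x$ in $s$. Terms are taken modulo $\alpha$-conversion. Substitutions are finite partial maps from symbols to terms, acting capture-avoidingly on variable occurrences. A match is a substitution, $\mathtt{fail}$ or $\mathtt{wait}$ (decided if not $\mathtt{wait}$). Data structures are $d::=\hat x\mid d\,t$; matchable forms are $m::=d\mid\lambda_\theta t.t$. $\mu\uplus\mu'$ is $\mathtt{fail}$ if either match is $\mathtt{fail}$; else $\mathtt{wait}$ if either is $\mathtt{wait}$; else $\mathtt{fail}$ if the domains intersect; else the union. Matching $\{p/u\}_\theta$ (first applicable clause): 1. $\{\hat x/u\}_\theta=\{x\mapsto u\}$ if $x\in\theta$; 2. $\{\hat x/\hat x\}_\theta=\{\}$ if $x\notin\theta$; 3. $\{p\,q/t\,u\}_\theta=\{p/t\}_\theta\uplus\{q/u\}_\theta$ if both are matchable forms; 4. $\mathtt{fail}$ if $p,u$ are matchable forms; 5. $\mathtt{wait}$ otherwise. A substitution result whose domain is not exactly $\theta$ becomes $\mathtt{fail}$. $\mathtt{fail}$ applied to any term gives $\lambda_{[x]}\hat x.x$. $\to_{PPC}$ is the contextual closure of $(\lambda_\theta p.s)u\to\{p/u\}_\theta s$ when the match is decided.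 **PPC_dB.** Terms: $t::=\mathsf v_{i,j}\mid\mathsf m_{i,j}\mid t\,t\mid\lambda_np.s$, with $i,j\ge1$ and $n\in\mathbb N$. For a set $S$ of pairs, $S-1$ subtracts $1$ from each primary index and drops the non-positive ones. Free indices: $fv(\mathsf v_{i,j})=\{(i,j)\}$, $fm(\mathsf m_{i,j})=\{(i,j)\}$ (empty otherwise); both are unions on applications; $fv(\lambda_np.s)=fv(p)\cup(fv(s)-1)$ and $fm(\lambda_np.s)=(fm(p)-1)\cup fm(s)$. Well-formed: every free index has secondary index $1$, and in each subterm $\lambda_np.s$ every pair $(1,j)\in fm(p)\cup fv(s)$ has $j\le n$. Increments and decrement: - $\uparrow^{\mathsf v}_k\mathsf v_{i,j}=\mathsf v_{i+1,j}$ if $i>k$, else unchanged; matchables unchanged; homomorphic on applications; $\uparrow^{\mathsf v}_k(\lambda_np.s)=\lambda_n\uparrow^{\mathsf v}_kp.\uparrow^{\mathsf v}_{k+1}s$; - $\uparrow^{\mathsf m}_k$ is symmetric, with $\uparrow^{\mathsf m}_k(\lambda_np.s)=\lambda_n\uparrow^{\mathsf m}_{k+1}p.\uparrow^{\mathsf m}_ks$; - $\downarrow^{\mathsf v}_k$ is like $\uparrow^{\mathsf v}_k$ but subtracts $1$; - the default depth is $0$. Substitution at level $i$, $\{\mathsf v_{i,j}\mapsto u_j\}_{j\in J}$: - maps $\mathsf v_{i,k}$ to $u_k$ ($k\in J$), leaves $\mathsf v_{i',k}$ with $i'\ne i$ and matchables unchanged; - is homomorphic on applications; - maps $\lambda_np.s$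 to $\lambda_n(\{\mathsf v_{i,j}\mapsto\uparrow^{\mathsf m}u_j\}p).(\{\mathsf v_{i+1,j}\mapsto\uparrow^{\mathsf v}u_j\}s)$. Data structures are $d::=\mathsf m_{i,j}\mid d\,t$; matchable forms are $m::=d\mid\lambda_nt.t$. Matching $\{p/u\}_n$: $\{\mathsf m_{1,j}/u\}_n=\{\mathsf v_{1,j}\mapsto u\}$; $\{\mathsf m_{i+1,j}/\mathsf m_{i,j}\}_n=\{\}$; then the application, $\mathtt{fail}$ and $\mathtt{wait}$ clauses as in PPC. A result whose domain is not $\{\mathsf v_{1,1},\dots,\mathsf v_{1,n}\}$ becomes $\mathtt{fail}$. $\mathtt{fail}$ applied to any term gives $\lambda_1\mathsf m_{1,1}.\mathsf v_{1,1}$. $\to_{dB}$ is the contextual closure of $(\lambda_np.s)u\to\downarrow^{\mathsf v}(\{p/\uparrow^{\mathsf v}u\}_ns)$ when the match is decided. **Backward translation.** For $V,M$ lists of lists of distinct symbols ($V_{ij}$ is the $j$-th element of the $i$-th list; $\theta++V$ means $[\theta]++V$): - $\mathcal U_{V,M}(\mathsf v_{i,j})=V_{ij}$ and $\mathcal U_{V,M}(\mathsf m_{i,j})=\widehat{M_{ij}}$; - homomorphic on applications; - $\mathcal U_{V,M}(\lambda_np.s)=\lambda_\theta\mathcal U_{V,\theta++M}(p).\mathcal U_{\theta++V,M}(s)$, with $\theta$ a list of $n$ fresh symbols. Fixing an enumeration $x_1,x_2,\dots$ of the symbols, $\mathcal U(t)=\mathcal U_{X,X}(t)$ with $X=[[x_1],\dots,[x_n]]$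 and $fv(t)\cup fm(t)\subseteq\{(1,1),\dots,(n,1)\}$. -}

module Defs where

open import Data.Nat using (ℕ; zero; suc; _+_; _∸_; _≤_; _<ᵇ_; _≡ᵇ_; _⊔_)
open import Data.Bool using (Bool; true; false; if_then_else_; _∧_; not)
open import Data.List using (List; []; _∷_; _++_; map; concat; concatMap; length; upTo; foldr; filterᵇ)
open import Data.Bool.ListAction using (any; all)
open import Data.List.Membership.Propositional using (_∈_)
open import Data.Product using (_×_; _,_; proj₁; proj₂; Σ)
open import Data.Unit using (⊤)
open import Relation.Binary.PropositionalEquality using (_≡_)

Sym : Set
Sym = ℕ

elem : ℕ → List ℕ → Bool
elem x = any (x ≡ᵇ_)

setEq : List ℕ → List ℕ → Bool
setEq a b = all (λ x → elem x b) a ∧ all (λ x → elem x a) b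

maxL : List ℕ → ℕ
maxL = foldr _⊔_ 0

fresh : ℕ → List Sym → List Sym
fresh n L = map (λ k → suc (maxL L) + k) (upTo n)

data Match (A : Set) : Set where
  fail : Match A
  wait : Match A
  ok   : List (ℕ × A) → Match A

disjoint : {A : Set} → List (ℕ × A) → List (ℕ × A) → Bool
disjoint σ τ = not (any (λ k → elem k (map proj₁ τ)) (map proj₁ σ))

_⊎M_ : {A : Set} → Match A → Match A → Match A
fail ⊎M _ = fail
wait ⊎M fail = fail
wait ⊎M wait = wait
wait ⊎M ok _ = wait
ok _ ⊎M fail = fail
ok _ ⊎M wait = wait
ok σ ⊎M ok τ = if disjoint σ τ then ok (σ ++ τ) else fail

checkDom : {A : Set} → List ℕ → Match A → Match A
checkDom dom (ok σ) = if setEq (map proj₁ σ) dom then ok σ else fail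
checkDom dom fail = fail
checkDom dom wait = wait

lookupσ : {A : Set} → List (ℕ × A) → ℕ → A → A
lookupσ [] k d = d
lookupσ ((k' , a) ∷ σ) k d = if k' ≡ᵇ k then a else lookupσ σ k d

-- PPC (named terms; α-conversion handled by the relation _≈α_)

data Term : Set where
  var : Sym → Term
  mat : Sym → Term
  _·_ : Term → Term → Term
  lam : List Sym → Term → Term → Term

fv : Term → List Sym
fv (var x) = x ∷ []
fv (mat x) = []
fv (a · b) = fv a ++ fv b
fv (lam θ p s) = fv p ++ filterᵇ (λ x → not (elem x θ)) (fv s)

fm : Term → List Sym
fm (var x) = []
fm (mat x) = x ∷ []
fm (a · b) = fm a ++ fm b
fm (lam θ p s) = filterᵇ (λ x → not (elem x θ)) (fm p) ++ fm s

names : Term → List Sym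
names (var x) = x ∷ []
names (mat x) = x ∷ []
names (a · b) = names a ++ names b
names (lam θ p s) = θ ++ names p ++ names s

ext : (Sym → Term) → (Sym → Term) → List Sym → List Sym → Sym → Term
ext mk σ (y ∷ θ) (z ∷ θ') x = if x ≡ᵇ y then mk z else ext mk σ θ θ' x
ext mk σ _ _ x = σ x

sub : (Sym → Term) → (Sym → Term) → Term → Term
sub σv σm (var x) = σv x
sub σv σm (mat x) = σm x
sub σv σm (a · b) = sub σv σm a · sub σv σm b
sub σv σm (lam θ p s) =
  lam θ' (sub σv (ext mat σm θ θ') p) (sub (ext var σv θ θ') σm s)
  where
    t : Term
    t = lam θ p s
    θ' : List Sym
    θ' = fresh (length θ)
           (names t ++ concatMap (λ x → names (σv x)) (fv t)
                    ++ concatMap (λ x → names (σm x)) (fm t))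

renM : List Sym → List Sym → Term → Term
renM θ z p = sub var (ext mat mat θ z) p

renV : List Sym → List Sym → Term → Term
renV θ z s = sub (ext var var θ z) mat s

data _≈α_ : Term → Term → Set where
  var : ∀ {x} → var x ≈α var x
  mat : ∀ {x} → mat x ≈α mat x
  app : ∀ {a a' b b'} → a ≈α a' → b ≈α b' → (a · b) ≈α (a' · b')
  lam : ∀ {θ θ' p p' s s'} → length θ ≡ length θ' →
        renM θ (fresh (length θ) (names (lam θ p s) ++ names (lam θ' p' s'))) p
          ≈α renM θ' (fresh (length θ) (names (lam θ p s) ++ names (lam θ' p' s'))) p' →
        renV θ (fresh (length θ) (names (lam θ p s) ++ names (lam θ' p' s'))) s
          ≈α renV θ' (fresh (length θ) (names (lam θ p s) ++ names (lam θ' p' s'))) s' →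
        lam θ p s ≈α lam θ' p' s'

isData : Term → Bool
isData (mat _) = true
isData (a · _) = isData a
isData _ = false

isMF : Term → Bool
isMF (lam _ _ _) = true
isMF t = isData t

isMat : Sym → Term → Bool
isMat x (mat y) = x ≡ᵇ y
isMat x _ = false

match : List Sym → Term → Term → Match Term
match θ (mat x) u =
  if elem x θ then ok ((x , u) ∷ [])
  else (if isMat x u then ok []
        else (if isMF u then fail else wait))
match θ (p · q) (t · u) =
  if isData (p · q) ∧ isData (t · u) then match θ p t ⊎M match θ q u
  else (if isMF (p · q) ∧ isMF (t · u) then fail else wait)
match θ p u = if isMF p ∧ isMF u then fail else wait

env : List (Sym × Term) → Sym → Term
env σ x = lookupσ σ x (var x)

failTerm : Term
failTerm = lam (0 ∷ []) (mat 0) (var 0)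

data _⟶₀_ : Term → Term → Set where
  βok   : ∀ {θ p s u σ} → checkDom θ (match θ p u) ≡ ok σ →
          (lam θ p s · u) ⟶₀ sub (env σ) mat s
  βfail : ∀ {θ p s u} → checkDom θ (match θ p u) ≡ fail →
          (lam θ p s · u) ⟶₀ failTerm
  appL  : ∀ {a a' b} → a ⟶₀ a' → (a · b) ⟶₀ (a' · b)
  appR  : ∀ {a b b'} → b ⟶₀ b' → (a · b) ⟶₀ (a · b')
  lamP  : ∀ {θ p p' s} → p ⟶₀ p' → lam θ p s ⟶₀ lam θ p' s
  lamS  : ∀ {θ p s s'} → s ⟶₀ s' → lam θ p s ⟶₀ lam θ p s'

-- →_PPC on α-equivalence classes
_⟶PPC_ : Term → Term → Set
a ⟶PPC b = Σ Term λ a' → Σ Term λ b' → (a ≈α a') × (a' ⟶₀ b') × (b' ≈α b)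

data DTerm : Set where
  v    : ℕ → ℕ → DTerm
  m    : ℕ → ℕ → DTerm
  _·ᵈ_ : DTerm → DTerm → DTerm
  lamᵈ : ℕ → DTerm → DTerm → DTerm

-- all indices are ≥ 1 (part of the grammar of PPC_dB terms)
Idx : DTerm → Set
Idx (v i j) = (1 ≤ i) × (1 ≤ j)
Idx (m i j) = (1 ≤ i) × (1 ≤ j)
Idx (a ·ᵈ b) = Idx a × Idx b
Idx (lamᵈ n p s) = Idx p × Idx s

minus1 : List (ℕ × ℕ) → List (ℕ × ℕ)
minus1 S = map (λ ij → (proj₁ ij ∸ 1 , proj₂ ij)) (filterᵇ (λ ij → 1 <ᵇ proj₁ ij) S)

fvD : DTerm → List (ℕ × ℕ)
fvD (v i j) = (i , j) ∷ []
fvD (m i j) = []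
fvD (a ·ᵈ b) = fvD a ++ fvD b
fvD (lamᵈ n p s) = fvD p ++ minus1 (fvD s)

fmD : DTerm → List (ℕ × ℕ)
fmD (v i j) = []
fmD (m i j) = (i , j) ∷ []
fmD (a ·ᵈ b) = fmD a ++ fmD b
fmD (lamᵈ n p s) = minus1 (fmD p) ++ fmD s

LocWF : DTerm → Set
LocWF (v i j) = ⊤
LocWF (m i j) = ⊤
LocWF (a ·ᵈ b) = LocWF a × LocWF b
LocWF (lamᵈ n p s) =
  (∀ {j} → (1 , j) ∈ fmD p ++ fvD s → j ≤ n) × LocWF p × LocWF s

WF : DTerm → Set
WF t = (∀ {i j} → (i , j) ∈ fvD t ++ fmD t → j ≡ 1) × LocWF t

upV : ℕ → DTerm → DTerm
upV k (v i j) = if k <ᵇ i then v (suc i) j else v i j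
upV k (m i j) = m i j
upV k (a ·ᵈ b) = upV k a ·ᵈ upV k b
upV k (lamᵈ n p s) = lamᵈ n (upV k p) (upV (suc k) s)

upM : ℕ → DTerm → DTerm
upM k (v i j) = v i j
upM k (m i j) = if k <ᵇ i then m (suc i) j else m i j
upM k (a ·ᵈ b) = upM k a ·ᵈ upM k b
upM k (lamᵈ n p s) = lamᵈ n (upM (suc k) p) (upM k s)

downV : ℕ → DTerm → DTerm
downV k (v i j) = if k <ᵇ i then v (i ∸ 1) j else v i j
downV k (m i j) = m i j
downV k (a ·ᵈ b) = downV k a ·ᵈ downV k b
downV k (lamᵈ n p s) = lamᵈ n (downV k p) (downV (suc k) s)

mapσ : (DTerm → DTerm) → List (ℕ × DTerm) → List (ℕ × DTerm)
mapσ f = map (λ ju → (proj₁ ju , f (proj₂ ju)))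

-- substitution at level i, {v_{i,j} ↦ u_j}_{j ∈ J}, σ = list of (j , u_j)
substD : ℕ → List (ℕ × DTerm) → DTerm → DTerm
substD i σ (v i' k) = if i' ≡ᵇ i then lookupσ σ k (v i' k) else v i' k
substD i σ (m i' k) = m i' k
substD i σ (a ·ᵈ b) = substD i σ a ·ᵈ substD i σ b
substD i σ (lamᵈ n p s) =
  lamᵈ n (substD i (mapσ (upM 0) σ) p) (substD (suc i) (mapσ (upV 0) σ) s)

isDataD : DTerm → Bool
isDataD (m _ _) = true
isDataD (a ·ᵈ _) = isDataD a
isDataD _ = false

isMFD : DTerm → Bool
isMFD (lamᵈ _ _ _) = true
isMFD t = isDataD t

isMD : ℕ → ℕ → DTerm → Bool
isMD i j (m i' j') = (i ≡ᵇ i') ∧ (j ≡ᵇ j')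
isMD i j _ = false

-- matching {p/u}_n ; a result (j , u) stands for v_{1,j} ↦ u
matchD : ℕ → DTerm → DTerm → Match DTerm
matchD n (m (suc zero) j) u = ok ((j , u) ∷ [])
matchD n (m (suc (suc i)) j) u =
  if isMD (suc i) j u then ok []
  else (if isMFD u then fail else wait)
matchD n (p ·ᵈ q) (t ·ᵈ u) =
  if isDataD (p ·ᵈ q) ∧ isDataD (t ·ᵈ u) then matchD n p t ⊎M matchD n q u
  else (if isMFD (p ·ᵈ q) ∧ isMFD (t ·ᵈ u) then fail else wait)
matchD n p u = if isMFD p ∧ isMFD u then fail else wait

failD : DTerm
failD = lamᵈ 1 (m 1 1) (v 1 1)

oneTo : ℕ → List ℕ
oneTo n = map suc (upTo n)

data _⟶dB_ : DTerm → DTerm → Set where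
  βok   : ∀ {n p s u σ} → checkDom (oneTo n) (matchD n p (upV 0 u)) ≡ ok σ →
          (lamᵈ n p s ·ᵈ u) ⟶dB downV 0 (substD 1 σ s)
  βfail : ∀ {n p s u} → checkDom (oneTo n) (matchD n p (upV 0 u)) ≡ fail →
          (lamᵈ n p s ·ᵈ u) ⟶dB downV 0 failD
  appL  : ∀ {a a' b} → a ⟶dB a' → (a ·ᵈ b) ⟶dB (a' ·ᵈ b)
  appR  : ∀ {a b b'} → b ⟶dB b' → (a ·ᵈ b) ⟶dB (a ·ᵈ b')
  lamP  : ∀ {n p p' s} → p ⟶dB p' → lamᵈ n p s ⟶dB lamᵈ n p' s
  lamS  : ∀ {n p s s'} → s ⟶dB s' → lamᵈ n p s ⟶dB lamᵈ n p s'

-- 1-based lookups (junk value 0 out of range; never used for well-formed terms)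
nth : List Sym → ℕ → Sym
nth (x ∷ xs) (suc zero) = x
nth (x ∷ xs) (suc (suc j)) = nth xs (suc j)
nth _ _ = 0

look : List (List Sym) → ℕ → ℕ → Sym
look (l ∷ L) (suc zero) j = nth l j
look (l ∷ L) (suc (suc i)) j = look L (suc i) j
look _ _ _ = 0

UE : List (List Sym) → List (List Sym) → DTerm → Term
UE V M (v i j) = var (look V i j)
UE V M (m i j) = mat (look M i j)
UE V M (a ·ᵈ b) = UE V M a · UE V M b
UE V M (lamᵈ n p s) = lam θ (UE V (θ ∷ M) p) (UE (θ ∷ V) M s)
  where
    θ : List Sym
    θ = fresh n (concat V ++ concat M)

-- enumeration of symbols: x_i = i - 1 (i ≥ 1); X = [[x_1],…,[x_N]] with
-- N the largest primary index of a free index of t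
U : DTerm → Term
U t = UE X X t
  where
    X : List (List Sym)
    X = map (λ k → k ∷ []) (upTo (maxL (map proj₁ (fvD t ++ fmD t))))

-- The proof is a simulation argument through a REPRESENTATION relation
-- Rep V M t a  between a de Bruijn term t and a named term a, relative to
-- naming contexts V (for variables) and M (for matchables): every index
-- v_{i,j} / m_{i,j} of t is the symbol at position j of the i-th level of
-- the context that it resolves to, and every binder λ_n of t is a λ_θ with
-- θ a list of n distinct symbols.
-- The theorem then follows: U t represents t, simulation gives a step to
-- some b representing t', and b ≈α U t' since both represent t'.
module Submission where

open import Defs
open import Data.Nat using (ℕ; zero; suc; _+_; _∸_; _≤_; _<_; _<ᵇ_; _≡ᵇ_; z≤n; s≤s; _≟_)
open import Data.Nat.Properties using (≤-trans; m≤m⊔n; m≤n⊔m; <-irrefl; ≤-<-trans; n≤1+n; suc-injective; ≤-pred; m≤m+n; +-suc; +-identityʳ; +-cancelˡ-≡; ≡ᵇ⇒≡; ≡⇒≡ᵇ; <ᵇ⇒<; <⇒<ᵇ; ≤⇒≯; ≮⇒≥; _≤?_; ≰⇒>)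
open import Data.Bool using (Bool; true; false; if_then_else_; _∧_; not; T)
open import Data.Bool.Properties using (T?)
open import Data.List using (List; []; _∷_; _++_; map; concat; concatMap; length; upTo; applyUpTo; filterᵇ)
open import Data.Bool.ListAction using (any; all)
open import Data.List.Relation.Unary.Any using (Any; here; there)
import Data.List.Relation.Unary.Any as Any
open import Data.List.Relation.Unary.Any.Properties using (any⁺; any⁻)
open import Data.List.Relation.Unary.All using (All; []; _∷_)
open import Data.List.Relation.Unary.AllPairs using ([]; _∷_)
open import Data.List.Relation.Unary.Unique.Propositional using (Unique)
open import Data.List.Relation.Unary.Unique.Propositional.Properties using (map⁺; upTo⁺; Unique[x∷xs]⇒x∉xs)
open import Data.List.Membership.Propositional using (_∈_; _∉_)
open import Data.List.Membership.Propositional.Properties using (∈-map⁺; ∈-map⁻; ∈-++⁺ˡ; ∈-++⁺ʳ; ∈-++⁻; ∈-concat⁺′; ∈-filter⁺; ∈-filter⁻; ∈-upTo⁺; ∈-upTo⁻)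
open import Data.List.Properties using (length-map; length-upTo)
open import Data.Product using (_×_; _,_; proj₁; proj₂; Σ)
open import Data.Sum using (_⊎_; inj₁; inj₂)
open import Data.Empty using (⊥-elim)
open import Data.Unit using (⊤; tt)
open import Data.Maybe using (Maybe; just; nothing; fromMaybe)
import Data.Maybe as Maybe
open import Relation.Nullary using (¬_; yes; no)
open import Relation.Binary.PropositionalEquality using (_≡_; _≢_; refl; sym; trans; cong; cong₂; subst)

T⇒≡true : ∀ {b} → T b → b ≡ true
T⇒≡true {true} _ = refl

≡true⇒T : ∀ {b} → b ≡ true → T b
≡true⇒T refl = tt

refute : ∀ {P : Set} b → (b ≡ true → P) → ¬ P → b ≡ false
refute false _ _ = refl
refute true sound np = ⊥-elim (np (sound refl))

bool-ext : ∀ (b c : Bool) → (b ≡ true → c ≡ true) → (c ≡ true → b ≡ true) → b ≡ c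
bool-ext false false _ _ = refl
bool-ext false true _ g = g refl
bool-ext true false f _ = sym (f refl)
bool-ext true true _ _ = refl

∧-l : ∀ b c → (b ∧ c) ≡ true → b ≡ true
∧-l true c _ = refl

∧-r : ∀ b c → (b ∧ c) ≡ true → c ≡ true
∧-r true c e = e

∧-intro : ∀ {b c} → b ≡ true → c ≡ true → (b ∧ c) ≡ true
∧-intro refl refl = refl

≡ᵇ-refl : ∀ n → (n ≡ᵇ n) ≡ true
≡ᵇ-refl n = T⇒≡true (≡⇒≡ᵇ n n refl)

≡ᵇ-sound : ∀ a n → (a ≡ᵇ n) ≡ true → a ≡ n
≡ᵇ-sound a n e = ≡ᵇ⇒≡ a n (≡true⇒T e)

≢⇒≡ᵇ-false : ∀ a n → a ≢ n → (a ≡ᵇ n) ≡ false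
≢⇒≡ᵇ-false a n = refute (a ≡ᵇ n) (≡ᵇ-sound a n)

<ᵇ-sound : ∀ a n → (a <ᵇ n) ≡ true → a < n
<ᵇ-sound a n e = <ᵇ⇒< a n (≡true⇒T e)

<⇒<ᵇ-true : ∀ a n → a < n → (a <ᵇ n) ≡ true
<⇒<ᵇ-true a n lt = T⇒≡true (<⇒<ᵇ lt)

≥⇒<ᵇ-false : ∀ a n → n ≤ a → (a <ᵇ n) ≡ false
≥⇒<ᵇ-false a n le = refute (a <ᵇ n) (<ᵇ-sound a n) (≤⇒≯ le)

<ᵇ-false⇒≥ : ∀ a n → (a <ᵇ n) ≡ false → n ≤ a
<ᵇ-false⇒≥ a n e = ≮⇒≥ (λ lt → true≢false (trans (sym (<⇒<ᵇ-true a n lt)) e))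
  where
    true≢false : true ≢ false
    true≢false ()

elem-sound : ∀ x l → elem x l ≡ true → x ∈ l
elem-sound x l e = Any.map (≡ᵇ⇒≡ x _) (any⁻ (x ≡ᵇ_) l (≡true⇒T e))

elem-complete : ∀ {x l} → x ∈ l → elem x l ≡ true
elem-complete {x} q = T⇒≡true (any⁺ (x ≡ᵇ_) (Any.map (λ { refl → ≡⇒≡ᵇ x x refl }) q))

elem-∉ : ∀ x l → x ∉ l → elem x l ≡ false
elem-∉ x l = refute (elem x l) (elem-sound x l)

all-true⁺ : ∀ {A : Set} (P : A → Bool) l → (∀ x → x ∈ l → P x ≡ true) → all P l ≡ true
all-true⁺ P [] f = refl
all-true⁺ P (x ∷ l) f rewrite f x (here refl) = all-true⁺ P l (λ y q → f y (there q))

all-true⁻ : ∀ {A : Set} (P : A → Bool) l → all P l ≡ true → ∀ x → x ∈ l → P x ≡ true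
all-true⁻ P (y ∷ l) e x (here refl) = ∧-l (P y) _ e
all-true⁻ P (y ∷ l) e x (there q) = all-true⁻ P l (∧-r (P y) _ e) x q

any-true⁺ : ∀ {A : Set} (P : A → Bool) l x → x ∈ l → P x ≡ true → any P l ≡ true
any-true⁺ P l x q e = T⇒≡true (any⁺ P (Any.map (λ { refl → ≡true⇒T e }) q))

any-true⁻ : ∀ {A : Set} (P : A → Bool) l → any P l ≡ true → Σ A λ x → x ∈ l × P x ≡ true
any-true⁻ P l e = witness (any⁻ P l (≡true⇒T e))
  where
    witness : ∀ {l} → Any (λ x → T (P x)) l → Σ _ λ x → x ∈ l × P x ≡ true
    witness (here px) = _ , here refl , T⇒≡true px
    witness (there q) with witness q
    ... | x , xin , px = x , there xin , px

∈-filterᵇ⁺ : ∀ {A : Set} (p : A → Bool) {x l} → x ∈ l → p x ≡ true → x ∈ filterᵇ p l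
∈-filterᵇ⁺ p q e = ∈-filter⁺ (λ y → T? (p y)) q (≡true⇒T e)

maxL-≤ : ∀ {x l} → x ∈ l → x ≤ maxL l
maxL-≤ {x} {y ∷ l} (here refl) = m≤m⊔n y (maxL l)
maxL-≤ {x} {y ∷ l} (there q) = ≤-trans (maxL-≤ q) (m≤n⊔m y (maxL l))

-- Res V x i j: the first level of the
-- context V containing x is the i-th, and x is at position j there; this is
-- how the index (i, j) denotes the name x.

data Pos : List Sym → Sym → ℕ → Set where
  phere : ∀ {x l} → Pos (x ∷ l) x 1
  pthere : ∀ {x y l j} → x ≢ y → Pos l x j → Pos (y ∷ l) x (suc j)

Ctx : Set
Ctx = List (List Sym)

data Res : Ctx → Sym → ℕ → ℕ → Set where
  rhere : ∀ {l L x j} → Pos l x j → Res (l ∷ L) x 1 j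
  rthere : ∀ {l L x i j} → x ∉ l → Res L x i j → Res (l ∷ L) x (suc i) j

pos-≥1 : ∀ {l x j} → Pos l x j → 1 ≤ j
pos-≥1 phere = s≤s z≤n
pos-≥1 (pthere _ _) = s≤s z≤n

pos-≤len : ∀ {l x j} → Pos l x j → j ≤ length l
pos-≤len phere = s≤s z≤n
pos-≤len (pthere _ p) = s≤s (pos-≤len p)

pos-nth : ∀ {l x j} → Pos l x j → nth l j ≡ x
pos-nth phere = refl
pos-nth (pthere {j = suc j} _ p) = pos-nth p

pos-∈ : ∀ {l x j} → Pos l x j → x ∈ l
pos-∈ phere = here refl
pos-∈ (pthere _ p) = there (pos-∈ p)

pos-fun : ∀ {l x j j'} → Pos l x j → Pos l x j' → j ≡ j'
pos-fun phere phere = refl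
pos-fun phere (pthere ne _) = ⊥-elim (ne refl)
pos-fun (pthere ne _) phere = ⊥-elim (ne refl)
pos-fun (pthere _ p) (pthere _ q) = cong suc (pos-fun p q)

pos-inj : ∀ {l x y j} → Pos l x j → Pos l y j → x ≡ y
pos-inj phere phere = refl
pos-inj (pthere _ p) (pthere _ q) = pos-inj p q

pos-of : ∀ {x l} → x ∈ l → Σ ℕ λ j → Pos l x j
pos-of {x} {y ∷ l} q with x ≟ y | q
... | yes refl | _ = 1 , phere
... | no ne | here e = ⊥-elim (ne e)
... | no ne | there q' with pos-of q'
... | j , p = suc j , pthere ne p

nth-pos : ∀ {l j} → Unique l → 1 ≤ j → j ≤ length l → Pos l (nth l j) j
nth-pos {x ∷ l} {suc zero} _ _ _ = phere
nth-pos {x ∷ l} {suc (suc j)} u@(_ ∷ u') _ (s≤s le) =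
  pthere (λ e → Unique[x∷xs]⇒x∉xs u (subst (_∈ l) e (pos-∈ p))) p
  where
    p : Pos l (nth l (suc j)) (suc j)
    p = nth-pos u' (s≤s z≤n) le

InRange : List Sym → ℕ → Set
InRange θ j = (1 ≤ j) × (j ≤ length θ)

pos-range : ∀ {l x j} → Pos l x j → InRange l j
pos-range ps = pos-≥1 ps , pos-≤len ps

nth-inj : ∀ {θ j j'} → Unique θ → InRange θ j → InRange θ j' → nth θ j ≡ nth θ j' → j ≡ j'
nth-inj u (a , b) (c , e) eq = pos-fun (nth-pos u a b) (subst (λ z → Pos _ z _) (sym eq) (nth-pos u c e))

nth-∈ : ∀ {θ j} → Unique θ → InRange θ j → nth θ j ∈ θ
nth-∈ u (a , b) = pos-∈ (nth-pos u a b)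

res-lvl : ∀ {L x i j} → Res L x i j → 1 ≤ i
res-lvl (rhere _) = s≤s z≤n
res-lvl (rthere _ _) = s≤s z≤n

res-pos : ∀ {L x i j} → Res L x i j → 1 ≤ j
res-pos (rhere p) = pos-≥1 p
res-pos (rthere _ r) = res-pos r

res-∈ : ∀ {L x i j} → Res L x i j → x ∈ concat L
res-∈ (rhere p) = ∈-++⁺ˡ (pos-∈ p)
res-∈ {l ∷ L} (rthere _ r) = ∈-++⁺ʳ l (res-∈ r)

res-fun : ∀ {L x i j i' j'} → Res L x i j → Res L x i' j' → (i ≡ i') × (j ≡ j')
res-fun (rhere p) (rhere q) = refl , pos-fun p q
res-fun (rhere p) (rthere nin _) = ⊥-elim (nin (pos-∈ p))
res-fun (rthere nin _) (rhere q) = ⊥-elim (nin (pos-∈ q))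
res-fun (rthere _ r) (rthere _ s) with res-fun r s
... | refl , e = refl , e

res-inj : ∀ {L x y i j} → Res L x i j → Res L y i j → x ≡ y
res-inj (rhere p) (rhere q) = pos-inj p q
res-inj (rthere _ r) (rthere _ s) = res-inj r s

res-prefix : ∀ W {V V' y a j} → Res (W ++ V) y a j → a ≤ length W → Res (W ++ V') y a j
res-prefix [] r le with ≤-trans (res-lvl r) le
... | ()
res-prefix (l ∷ W) (rhere p) _ = rhere p
res-prefix (l ∷ W) (rthere nin r) (s≤s le) = rthere nin (res-prefix W r le)

res-insert : ∀ W {V} θ {y a j} → Res (W ++ V) y a j → length W < a → y ∉ θ →
             Res (W ++ θ ∷ V) y (suc a) j
res-insert [] θ r _ nin = rthere nin r
res-insert (l ∷ W) θ (rthere nin' r) (s≤s lt) nin = rthere nin' (res-insert W θ r lt nin)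

fresh-len : ∀ n L → length (fresh n L) ≡ n
fresh-len n L = trans (length-map _ (upTo n)) (length-upTo n)

fresh-∉ : ∀ {x} n L → x ∈ L → x ∉ fresh n L
fresh-∉ {x} n L xin yin with ∈-map⁻ (λ k → suc (maxL L) + k) yin
... | k , _ , refl = <-irrefl refl (≤-<-trans (maxL-≤ xin) (s≤s (m≤m+n (maxL L) k)))

fresh-unique : ∀ n L → Unique (fresh n L)
fresh-unique n L = map⁺ (λ {a} {b} → +-cancelˡ-≡ (suc (maxL L)) a b) (upTo⁺ n)

ext-pos : ∀ (mk σ : Sym → Term) θ θ' {x j} → Pos θ x j → length θ ≡ length θ' →
          ext mk σ θ θ' x ≡ mk (nth θ' j)
ext-pos mk σ (y ∷ θ) (z ∷ θ') phere _ rewrite ≡ᵇ-refl y = refl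
ext-pos mk σ (y ∷ θ) (z ∷ θ') {x} (pthere {j = suc j} ne p) le
  rewrite ≢⇒≡ᵇ-false x y ne = ext-pos mk σ θ θ' p (suc-injective le)

ext-∉ : ∀ (mk σ : Sym → Term) θ θ' x → x ∉ θ → ext mk σ θ θ' x ≡ σ x
ext-∉ mk σ [] θ' x _ = refl
ext-∉ mk σ (y ∷ θ) [] x _ = refl
ext-∉ mk σ (y ∷ θ) (z ∷ θ') x nin
  rewrite ≢⇒≡ᵇ-false x y (λ e → nin (here e)) = ext-∉ mk σ θ θ' x (λ q → nin (there q))

data Rep (V M : Ctx) : DTerm → Term → Set where
  rvar : ∀ {x i j} → Res V x i j → Rep V M (v i j) (var x)
  rmat : ∀ {x i j} → Res M x i j → Rep V M (m i j) (mat x)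
  rapp : ∀ {t u a b} → Rep V M t a → Rep V M u b → Rep V M (t ·ᵈ u) (a · b)
  rlam : ∀ {n p s θ q r} → length θ ≡ n → Unique θ →
         Rep V (θ ∷ M) p q → Rep (θ ∷ V) M s r → Rep V M (lamᵈ n p s) (lam θ q r)

minus1⁻ : ∀ {S i j} → (i , j) ∈ minus1 S → ((suc i , j) ∈ S) × (1 ≤ i)
minus1⁻ {S} q with ∈-map⁻ (λ ij → (proj₁ ij ∸ 1 , proj₂ ij)) q
... | (i₀ , j₀) , q' , e with ∈-filter⁻ (λ ij → T? (1 <ᵇ proj₁ ij)) {xs = S} q'
minus1⁻ q | (suc (suc k) , j₀) , q' , refl | q'' , _ = q'' , s≤s z≤n

minus1⁺ : ∀ {S i j} → (suc (suc i) , j) ∈ S → (suc i , j) ∈ minus1 S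
minus1⁺ q = ∈-map⁺ (λ ij → (proj₁ ij ∸ 1 , proj₂ ij)) (∈-filterᵇ⁺ (λ ij → 1 <ᵇ proj₁ ij) q refl)

rep-fv : ∀ {V M t a} → Rep V M t a → ∀ {i j} → (i , j) ∈ fvD t → Σ Sym λ x → Res V x i j
rep-fv (rvar {x = x} r) (here refl) = x , r
rep-fv (rapp {t = t} r₁ r₂) q with ∈-++⁻ (fvD t) q
... | inj₁ q' = rep-fv r₁ q'
... | inj₂ q' = rep-fv r₂ q'
rep-fv (rlam {p = p} {s = s} _ _ rp rs) w with ∈-++⁻ (fvD p) w
... | inj₁ w' = rep-fv rp w'
... | inj₂ w' with minus1⁻ {fvD s} w'
... | w'' , s≤s z≤n with rep-fv rs w''
... | x , rthere _ res = x , res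

rep-fm : ∀ {V M t a} → Rep V M t a → ∀ {i j} → (i , j) ∈ fmD t → Σ Sym λ x → Res M x i j
rep-fm (rmat {x = x} r) (here refl) = x , r
rep-fm (rapp {t = t} r₁ r₂) q with ∈-++⁻ (fmD t) q
... | inj₁ q' = rep-fm r₁ q'
... | inj₂ q' = rep-fm r₂ q'
rep-fm (rlam {p = p} _ _ rp rs) w with ∈-++⁻ (minus1 (fmD p)) w
... | inj₂ w' = rep-fm rs w'
... | inj₁ w' with minus1⁻ {fmD p} w'
... | w'' , s≤s z≤n with rep-fm rp w''
... | x , rthere _ res = x , res

rep-idx : ∀ {V M t a} → Rep V M t a → Idx t
rep-idx (rvar r) = res-lvl r , res-pos r
rep-idx (rmat r) = res-lvl r , res-pos r
rep-idx (rapp r₁ r₂) = rep-idx r₁ , rep-idx r₂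
rep-idx (rlam _ _ rp rs) = rep-idx rp , rep-idx rs

rep-loc : ∀ {V M t a} → Rep V M t a → LocWF t
rep-loc (rvar _) = tt
rep-loc (rmat _) = tt
rep-loc (rapp r₁ r₂) = rep-loc r₁ , rep-loc r₂
rep-loc (rlam {p = p} {s = s} {θ = θ} refl _ rp rs) = bound , rep-loc rp , rep-loc rs
  where
    bound : ∀ {j} → (1 , j) ∈ fmD p ++ fvD s → j ≤ length θ
    bound w with ∈-++⁻ (fmD p) w
    ... | inj₁ w' with rep-fm rp w'
    ... | _ , rhere ps = pos-≤len ps
    bound w | inj₂ w' with rep-fv rs w'
    ... | _ , rhere ps = pos-≤len ps

idx-fv : ∀ t → Idx t → ∀ {i j} → (i , j) ∈ fvD t → (1 ≤ i) × (1 ≤ j)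
idx-fv (v i j) d (here refl) = d
idx-fv (t ·ᵈ u) (d₁ , d₂) q with ∈-++⁻ (fvD t) q
... | inj₁ q' = idx-fv t d₁ q'
... | inj₂ q' = idx-fv u d₂ q'
idx-fv (lamᵈ n p s) (d₁ , d₂) q with ∈-++⁻ (fvD p) q
... | inj₁ q' = idx-fv p d₁ q'
... | inj₂ q' with minus1⁻ {fvD s} q'
... | q'' , le = le , proj₂ (idx-fv s d₂ q'')

idx-fm : ∀ t → Idx t → ∀ {i j} → (i , j) ∈ fmD t → (1 ≤ i) × (1 ≤ j)
idx-fm (m i j) d (here refl) = d
idx-fm (t ·ᵈ u) (d₁ , d₂) q with ∈-++⁻ (fmD t) q
... | inj₁ q' = idx-fm t d₁ q'
... | inj₂ q' = idx-fm u d₂ q'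
idx-fm (lamᵈ n p s) (d₁ , d₂) q with ∈-++⁻ (minus1 (fmD p)) q
... | inj₂ q' = idx-fm s d₂ q'
... | inj₁ q' with minus1⁻ {fmD p} q'
... | q'' , le = le , proj₂ (idx-fm p d₁ q'')

Resolves : Ctx → ℕ × ℕ → Set
Resolves V (i , j) = Res V (look V i j) i j

fresh-level-resolves : ∀ {n j} L V → 1 ≤ j → j ≤ n → Resolves (fresh n L ∷ V) (1 , j)
fresh-level-resolves {n} {j} L V j1 le =
  rhere (nth-pos (fresh-unique n L) j1 (subst (j ≤_) (sym (fresh-len n L)) le))

fresh-level-shifts : ∀ {n i j} L V → (∀ {x} → x ∈ concat V → x ∈ L) →
                     Resolves V (suc i , j) → Resolves (fresh n L ∷ V) (suc (suc i) , j)
fresh-level-shifts {n} L V inL r = rthere (fresh-∉ n L (inL (res-∈ r))) r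

UE-represents : ∀ V M t → Idx t → LocWF t →
                (∀ {i j} → (i , j) ∈ fvD t → Resolves V (i , j)) →
                (∀ {i j} → (i , j) ∈ fmD t → Resolves M (i , j)) →
                Rep V M t (UE V M t)
UE-represents V M (v i j) _ _ cv _ = rvar (cv (here refl))
UE-represents V M (m i j) _ _ _ cm = rmat (cm (here refl))
UE-represents V M (t ·ᵈ u) (d₁ , d₂) (l₁ , l₂) cv cm =
  rapp (UE-represents V M t d₁ l₁ (λ q → cv (∈-++⁺ˡ q)) (λ q → cm (∈-++⁺ˡ q)))
       (UE-represents V M u d₂ l₂ (λ q → cv (∈-++⁺ʳ (fvD t) q)) (λ q → cm (∈-++⁺ʳ (fmD t) q)))
UE-represents V M (lamᵈ n p s) (d₁ , d₂) (bound , l₁ , l₂) cv cm =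
  rlam (fresh-len n L) (fresh-unique n L)
       (UE-represents V (θ ∷ M) p d₁ l₁ (λ q → cv (∈-++⁺ˡ q)) cmp)
       (UE-represents (θ ∷ V) M s d₂ l₂ cvs (λ q → cm (∈-++⁺ʳ (minus1 (fmD p)) q)))
  where
    L = concat V ++ concat M
    θ = fresh n L
    cmp : ∀ {i j} → (i , j) ∈ fmD p → Resolves (θ ∷ M) (i , j)
    cmp {i} q with idx-fm p d₁ q
    cmp {suc zero} q | _ , j1 = fresh-level-resolves L M j1 (bound (∈-++⁺ˡ q))
    cmp {suc (suc i)} q | _ , _ =
      fresh-level-shifts L M (∈-++⁺ʳ (concat V)) (cm (∈-++⁺ˡ (minus1⁺ {fmD p} q)))
    cvs : ∀ {i j} → (i , j) ∈ fvD s → Resolves (θ ∷ V) (i , j)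
    cvs {i} q with idx-fv s d₂ q
    cvs {suc zero} q | _ , j1 = fresh-level-resolves L V j1 (bound (∈-++⁺ʳ (fmD p) q))
    cvs {suc (suc i)} q | _ , _ =
      fresh-level-shifts L V ∈-++⁺ˡ (cv (∈-++⁺ʳ (fvD p) (minus1⁺ {fvD s} q)))

down-up : ∀ c t → downV c (upV c t) ≡ t
down-up c (v i j) with c <ᵇ i in eq
... | true rewrite <⇒<ᵇ-true c (suc i) (≤-trans (<ᵇ-sound c i eq) (n≤1+n i)) = refl
... | false rewrite eq = refl
down-up c (m i j) = refl
down-up c (t ·ᵈ u) = cong₂ _·ᵈ_ (down-up c t) (down-up c u)
down-up c (lamᵈ n p s) = cong₂ (lamᵈ n) (down-up c p) (down-up (suc c) s)

down-upM : ∀ k c t → downV k (upM c t) ≡ upM c (downV k t)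
down-upM k c (v i j) with k <ᵇ i
... | true = refl
... | false = refl
down-upM k c (m i j) with c <ᵇ i
... | true = refl
... | false = refl
down-upM k c (t ·ᵈ u) = cong₂ _·ᵈ_ (down-upM k c t) (down-upM k c u)
down-upM k c (lamᵈ n p s) = cong₂ (lamᵈ n) (down-upM k (suc c) p) (down-upM (suc k) c s)

downV-v-t : ∀ k a j → (k <ᵇ a) ≡ true → downV k (v a j) ≡ v (a ∸ 1) j
downV-v-t k a j e rewrite e = refl

downV-v-f : ∀ k a j → (k <ᵇ a) ≡ false → downV k (v a j) ≡ v a j
downV-v-f k a j e rewrite e = refl

upV-v-t : ∀ k a j → (k <ᵇ a) ≡ true → upV k (v a j) ≡ v (suc a) j
upV-v-t k a j e rewrite e = refl

upV-v-f : ∀ k a j → (k <ᵇ a) ≡ false → upV k (v a j) ≡ v a j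
upV-v-f k a j e rewrite e = refl

-- Gap c g u: no variable index of u (read at binder depth c) falls in the
-- window (c, c + g].  Shifting up at c opens the window by one; terms
-- substituted by the β-rule have been shifted, so they carry such a gap,
-- which is what lets a further ↓ᵛ be undone by inserting a context level.
Gap : ℕ → ℕ → DTerm → Set
Gap c g (v a j) = (a ≤ c) ⊎ (c + g < a)
Gap c g (m _ _) = ⊤
Gap c g (x ·ᵈ y) = Gap c g x × Gap c g y
Gap c g (lamᵈ n p s) = Gap c g p × Gap (suc c) g s

gap0 : ∀ c t → Gap c 0 t
gap0 c (v a j) with a ≤? c
... | yes le = inj₁ le
... | no nle = inj₂ (subst (_< a) (sym (+-identityʳ c)) (≰⇒> nle))
gap0 c (m _ _) = tt
gap0 c (x ·ᵈ y) = gap0 c x , gap0 c y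
gap0 c (lamᵈ n p s) = gap0 c p , gap0 (suc c) s

gapUp : ∀ c g t → Gap c g t → Gap c (suc g) (upV c t)
gapUp c g (v a j) (inj₁ le) rewrite ≥⇒<ᵇ-false c a le = inj₁ le
gapUp c g (v a j) (inj₂ lt) rewrite <⇒<ᵇ-true c a (≤-<-trans (m≤m+n c g) lt) =
  inj₂ (subst (_< suc a) (sym (+-suc c g)) (s≤s lt))
gapUp c g (m _ _) _ = tt
gapUp c g (x ·ᵈ y) (g₁ , g₂) = gapUp c g x g₁ , gapUp c g y g₂
gapUp c g (lamᵈ n p s) (g₁ , g₂) = gapUp c g p g₁ , gapUp (suc c) g s g₂

gapUpM : ∀ c g c' t → Gap c g t → Gap c g (upM c' t)
gapUpM c g c' (v a j) gp = gp
gapUpM c g c' (m i j) _ with c' <ᵇ i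
... | true = tt
... | false = tt
gapUpM c g c' (x ·ᵈ y) (g₁ , g₂) = gapUpM c g c' x g₁ , gapUpM c g c' y g₂
gapUpM c g c' (lamᵈ n p s) (g₁ , g₂) = gapUpM c g (suc c') p g₁ , gapUpM (suc c) g c' s g₂

-- Weakening: inserting a fresh level θ into a naming context corresponds to
-- shifting the indices that point beyond it.

NamesOut : Term → List Sym → Set
NamesOut b θ = ∀ y → y ∈ names b → y ∉ θ

namesOut-appl : ∀ {a b θ} → NamesOut (a · b) θ → NamesOut a θ
namesOut-appl f y yin = f y (∈-++⁺ˡ yin)

namesOut-appr : ∀ {a b θ} → NamesOut (a · b) θ → NamesOut b θ
namesOut-appr {a} f y yin = f y (∈-++⁺ʳ (names a) yin)

namesOut-pat : ∀ {θb q r θ} → NamesOut (lam θb q r) θ → NamesOut q θ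
namesOut-pat {θb} f y yin = f y (∈-++⁺ʳ θb (∈-++⁺ˡ yin))

namesOut-body : ∀ {θb q r θ} → NamesOut (lam θb q r) θ → NamesOut r θ
namesOut-body {θb} {q} f y yin = f y (∈-++⁺ʳ θb (∈-++⁺ʳ (names q) yin))

above-gap : ∀ c k a → c + suc k < suc a → (suc (c + k) < suc a) × (c < a)
above-gap c k a lt = lt' , ≤-<-trans (m≤m+n c k) (≤-pred lt')
  where
    lt' : suc (c + k) < suc a
    lt' = subst (_< suc a) (+-suc c k) lt

weakV-var : ∀ W c k {V M} θ a j {b} → length W ≡ c → Gap c (suc k) (v a j) → NamesOut b θ →
            Rep (W ++ V) M (downV (c + k) (v a j)) b →
            Rep (W ++ θ ∷ V) M (downV (c + suc k) (upV c (v a j))) b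
weakV-var W c k θ a j lw (inj₁ le) nb r
  rewrite upV-v-f c a j (≥⇒<ᵇ-false c a le)
        | downV-v-f (c + suc k) a j (≥⇒<ᵇ-false (c + suc k) a (≤-trans le (m≤m+n c (suc k))))
        | downV-v-f (c + k) a j (≥⇒<ᵇ-false (c + k) a (≤-trans le (m≤m+n c k)))
  with r
... | rvar res = rvar (res-prefix W res (subst (a ≤_) (sym lw) le))
weakV-var W c k θ (suc a) j lw (inj₂ lt) nb r
  rewrite upV-v-t c (suc a) j (<⇒<ᵇ-true c (suc a) (≤-<-trans (m≤m+n c (suc k)) lt))
        | downV-v-t (c + suc k) (suc (suc a)) j (<⇒<ᵇ-true (c + suc k) (suc (suc a)) (≤-trans lt (n≤1+n (suc a))))
        | downV-v-t (c + k) (suc a) j (<⇒<ᵇ-true (c + k) (suc a) (≤-trans (n≤1+n (suc (c + k))) (proj₁ (above-gap c k a lt))))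
  with r
... | rvar {x = y} res = rvar (res-insert W θ res (subst (_< a) (sym lw) (proj₂ (above-gap c k a lt))) (nb y (here refl)))

weakV : ∀ W c k {V M} θ u {b} → length W ≡ c → Gap c (suc k) u → NamesOut b θ →
        Rep (W ++ V) M (downV (c + k) u) b →
        Rep (W ++ θ ∷ V) M (downV (c + suc k) (upV c u)) b
weakV W c k θ (v a j) lw gp nb r = weakV-var W c k θ a j lw gp nb r
weakV W c k θ (m i j) lw gp nb (rmat r) = rmat r
weakV W c k θ (t ·ᵈ u) lw (g₁ , g₂) nb (rapp {a = a} {b = b} r₁ r₂) =
  rapp (weakV W c k θ t lw g₁ (namesOut-appl {a} {b} nb) r₁) (weakV W c k θ u lw g₂ (namesOut-appr {a} {b} nb) r₂)
weakV W c k θ (lamᵈ n p s) lw (g₁ , g₂) nb (rlam {θ = θb} {q = q} {r = r} le d rp rs) =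
  rlam le d (weakV W c k θ p lw g₁ (namesOut-pat {θb} {q} {r} nb) rp)
            (weakV (θb ∷ W) (suc c) k θ s (cong suc lw) g₂ (namesOut-body {θb} {q} {r} nb) rs)

weakM : ∀ W c {V M} θ u {b} → length W ≡ c → NamesOut b θ →
        Rep V (W ++ M) u b → Rep V (W ++ θ ∷ M) (upM c u) b
weakM W c θ (v i j) lw nb (rvar r) = rvar r
weakM W c θ (m a j) lw nb (rmat {x = y} r) with c <ᵇ a in eq
... | true = rmat (res-insert W θ r (subst (_< a) (sym lw) (<ᵇ-sound c a eq)) (nb y (here refl)))
... | false = rmat (res-prefix W r (subst (a ≤_) (sym lw) (<ᵇ-false⇒≥ c a eq)))
weakM W c θ (t ·ᵈ u) lw nb (rapp {a = a} {b = b} r₁ r₂) =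
  rapp (weakM W c θ t lw (namesOut-appl {a} {b} nb) r₁) (weakM W c θ u lw (namesOut-appr {a} {b} nb) r₂)
weakM W c θ (lamᵈ n p s) lw nb (rlam {θ = θb} {q = q} {r = r} le d rp rs) =
  rlam le d (weakM (θb ∷ W) (suc c) θ p (cong suc lw) (namesOut-pat {θb} {q} {r} nb) rp)
            (weakM W c θ s lw (namesOut-body {θb} {q} {r} nb) rs)

fv-names : ∀ a {x} → x ∈ fv a → x ∈ names a
fv-names (var x) q = q
fv-names (a · b) q with ∈-++⁻ (fv a) q
... | inj₁ q' = ∈-++⁺ˡ (fv-names a q')
... | inj₂ q' = ∈-++⁺ʳ (names a) (fv-names b q')
fv-names (lam θ p s) q with ∈-++⁻ (fv p) q
... | inj₁ q' = ∈-++⁺ʳ θ (∈-++⁺ˡ (fv-names p q'))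
... | inj₂ q' = ∈-++⁺ʳ θ (∈-++⁺ʳ (names p) (fv-names s (proj₁ (∈-filter⁻ (λ y → T? (not (elem y θ))) {xs = fv s} q'))))

fm-names : ∀ a {x} → x ∈ fm a → x ∈ names a
fm-names (mat x) q = q
fm-names (a · b) q with ∈-++⁻ (fm a) q
... | inj₁ q' = ∈-++⁺ˡ (fm-names a q')
... | inj₂ q' = ∈-++⁺ʳ (names a) (fm-names b q')
fm-names (lam θ p s) q with ∈-++⁻ (filterᵇ (λ x → not (elem x θ)) (fm p)) q
... | inj₁ q' = ∈-++⁺ʳ θ (∈-++⁺ˡ (fm-names p (proj₁ (∈-filter⁻ (λ y → T? (not (elem y θ))) {xs = fm p} q'))))
... | inj₂ q' = ∈-++⁺ʳ θ (∈-++⁺ʳ (names p) (fm-names s q'))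

fv-lam-body : ∀ θ p s {x} → x ∈ fv s → x ∉ θ → x ∈ fv (lam θ p s)
fv-lam-body θ p s {x} q nin =
  ∈-++⁺ʳ (fv p) (∈-filterᵇ⁺ (λ y → not (elem y θ)) q (cong not (elem-∉ x θ nin)))

fm-lam-pat : ∀ θ p s {x} → x ∈ fm p → x ∉ θ → x ∈ fm (lam θ p s)
fm-lam-pat θ p s {x} q nin =
  ∈-++⁺ˡ (∈-filterᵇ⁺ (λ y → not (elem y θ)) q (cong not (elem-∉ x θ nin)))

avoided : (Sym → Term) → (Sym → Term) → List Sym → Term → Term → List Sym
avoided σv σm θ p s = names (lam θ p s) ++ concatMap (λ x → names (σv x)) (fv (lam θ p s))
                                        ++ concatMap (λ x → names (σm x)) (fm (lam θ p s))

binder : (Sym → Term) → (Sym → Term) → List Sym → Term → Term → List Sym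
binder σv σm θ p s = fresh (length θ) (avoided σv σm θ p s)

binder-len : ∀ σv σm θ p s → length (binder σv σm θ p s) ≡ length θ
binder-len σv σm θ p s = fresh-len (length θ) (avoided σv σm θ p s)

binder-unique : ∀ σv σm θ p s → Unique (binder σv σm θ p s)
binder-unique σv σm θ p s = fresh-unique (length θ) (avoided σv σm θ p s)

binder-avoids-v : ∀ σv σm θ p s {x} → x ∈ fv (lam θ p s) → NamesOut (σv x) (binder σv σm θ p s)
binder-avoids-v σv σm θ p s xin y yin =
  fresh-∉ (length θ) (avoided σv σm θ p s)
    (∈-++⁺ʳ (names (lam θ p s)) (∈-++⁺ˡ (∈-concat⁺′ yin (∈-map⁺ (λ x → names (σv x)) xin))))

binder-avoids-m : ∀ σv σm θ p s {x} → x ∈ fm (lam θ p s) → NamesOut (σm x) (binder σv σm θ p s)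
binder-avoids-m σv σm θ p s xin y yin =
  fresh-∉ (length θ) (avoided σv σm θ p s)
    (∈-++⁺ʳ (names (lam θ p s)) (∈-++⁺ʳ (concatMap (λ x → names (σv x)) (fv (lam θ p s)))
       (∈-concat⁺′ yin (∈-map⁺ (λ x → names (σm x)) xin))))

binder-level : ∀ {θ θ' x j} {V : Ctx} → Unique θ' → length θ' ≡ length θ → Pos θ x j →
               Res (θ' ∷ V) (nth θ' j) 1 j
binder-level {j = j} u len ps = rhere (nth-pos u (pos-≥1 ps) (subst (j ≤_) (sym len) (pos-≤len ps)))

RenamesV : Ctx → Ctx → (Sym → Term) → Term → Set
RenamesV V V' σv a = ∀ x i j → x ∈ fv a → Res V x i j → Σ Sym λ y → (σv x ≡ var y) × Res V' y i j

RenamesM : Ctx → Ctx → (Sym → Term) → Term → Set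
RenamesM M M' σm a = ∀ x i j → x ∈ fm a → Res M x i j → Σ Sym λ y → (σm x ≡ mat y) × Res M' y i j

names-var : ∀ {t y} → t ≡ var y → y ∈ names t
names-var refl = here refl

names-mat : ∀ {t y} → t ≡ mat y → y ∈ names t
names-mat refl = here refl

renamesM-under : ∀ {M M'} σv σm θ p s → RenamesM M M' σm (lam θ p s) →
                 RenamesM (θ ∷ M) (binder σv σm θ p s ∷ M') (ext mat σm θ (binder σv σm θ p s)) p
renamesM-under σv σm θ p s hm x .1 j _ (rhere ps) =
  nth θ' j , ext-pos mat σm θ θ' ps (sym (binder-len σv σm θ p s)) ,
  binder-level (binder-unique σv σm θ p s) (binder-len σv σm θ p s) ps
  where θ' = binder σv σm θ p s
renamesM-under σv σm θ p s hm x (suc i) j xin (rthere nin r) with hm x i j (fm-lam-pat θ p s xin nin) r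
... | y , e , r' =
  y , trans (ext-∉ mat σm θ (binder σv σm θ p s) x nin) e ,
  rthere (binder-avoids-m σv σm θ p s (fm-lam-pat θ p s xin nin) y (names-mat e)) r'

renamesV-under : ∀ {V V'} σv σm θ p s → RenamesV V V' σv (lam θ p s) →
                 RenamesV (θ ∷ V) (binder σv σm θ p s ∷ V') (ext var σv θ (binder σv σm θ p s)) s
renamesV-under σv σm θ p s hv x .1 j _ (rhere ps) =
  nth θ' j , ext-pos var σv θ θ' ps (sym (binder-len σv σm θ p s)) ,
  binder-level (binder-unique σv σm θ p s) (binder-len σv σm θ p s) ps
  where θ' = binder σv σm θ p s
renamesV-under σv σm θ p s hv x (suc i) j xin (rthere nin r) with hv x i j (fv-lam-body θ p s xin nin) r
... | y , e , r' =
  y , trans (ext-∉ var σv θ (binder σv σm θ p s) x nin) e ,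
  rthere (binder-avoids-v σv σm θ p s (fv-lam-body θ p s xin nin) y (names-var e)) r'

rename : ∀ {V M V' M' t a} σv σm → Rep V M t a → RenamesV V V' σv a → RenamesM M M' σm a →
         Rep V' M' t (sub σv σm a)
rename σv σm (rvar {x = x} {i} {j} r) hv hm with hv x i j (here refl) r
... | y , e , r' = subst (Rep _ _ (v i j)) (sym e) (rvar r')
rename σv σm (rmat {x = x} {i} {j} r) hv hm with hm x i j (here refl) r
... | y , e , r' = subst (Rep _ _ (m i j)) (sym e) (rmat r')
rename σv σm (rapp {a = a} r₁ r₂) hv hm =
  rapp (rename σv σm r₁ (λ x i j q → hv x i j (∈-++⁺ˡ q)) (λ x i j q → hm x i j (∈-++⁺ˡ q)))
       (rename σv σm r₂ (λ x i j q → hv x i j (∈-++⁺ʳ (fv a) q)) (λ x i j q → hm x i j (∈-++⁺ʳ (fm a) q)))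
rename σv σm (rlam {θ = θ} {q = p} {r = s} le _ rp rs) hv hm =
  rlam (trans (binder-len σv σm θ p s) le) (binder-unique σv σm θ p s)
       (rename σv (ext mat σm θ θ') rp (λ x i j q → hv x i j (∈-++⁺ˡ q)) (renamesM-under σv σm θ p s hm))
       (rename (ext var σv θ θ') σm rs (renamesV-under σv σm θ p s hv)
          (λ x i j q → hm x i j (∈-++⁺ʳ (filterᵇ (λ x → not (elem x θ)) (fm p)) q)))
  where θ' = binder σv σm θ p s

lk : {A : Set} → List (ℕ × A) → ℕ → Maybe A
lk [] j = nothing
lk ((k , a) ∷ σ) j = if k ≡ᵇ j then just a else lk σ j

lookup-lk : ∀ {A : Set} (σ : List (ℕ × A)) j d → lookupσ σ j d ≡ fromMaybe d (lk σ j)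
lookup-lk [] j d = refl
lookup-lk ((k , a) ∷ σ) j d with k ≡ᵇ j
... | true = refl
... | false = lookup-lk σ j d

lk-map : ∀ (f : DTerm → DTerm) σ j → lk (mapσ f σ) j ≡ Maybe.map f (lk σ j)
lk-map f [] j = refl
lk-map f ((k , a) ∷ σ) j with k ≡ᵇ j
... | true = refl
... | false = lk-map f σ j

GapS : ℕ → List (ℕ × DTerm) → Set
GapS k σ = All (λ p → Gap 0 (suc k) (proj₂ p)) σ

lk-gap : ∀ {k} σ j {u} → GapS k σ → lk σ j ≡ just u → Gap 0 (suc k) u
lk-gap ((k , a) ∷ σ) j (g ∷ gs) e with k ≡ᵇ j
lk-gap ((k , a) ∷ σ) j (g ∷ gs) refl | true = g
... | false = lk-gap σ j gs e

gapS-upM : ∀ {k} σ → GapS k σ → GapS k (mapσ (upM 0) σ)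
gapS-upM [] [] = []
gapS-upM ((_ , u) ∷ σ) (g ∷ gs) = gapUpM 0 _ 0 u g ∷ gapS-upM σ gs

gapS-upV : ∀ {k} σ → GapS k σ → GapS (suc k) (mapσ (upV 0) σ)
gapS-upV [] [] = []
gapS-upV ((_ , u) ∷ σ) (g ∷ gs) = gapUp 0 _ u g ∷ gapS-upV σ gs

var-anyM : ∀ {V M M'} k i j {b} → Rep V M (downV k (v i j)) b → Rep V M' (downV k (v i j)) b
var-anyM k i j r with k <ᵇ i | r
... | true | rvar res = rvar res
... | false | rvar res = rvar res

var-shift : ∀ {V M} θ k a j {b} → NamesOut b θ → Rep V M (downV k (v a j)) b →
            Rep (θ ∷ V) M (downV (suc k) (v (suc a) j)) b
var-shift θ k a j nb r with k <ᵇ a in eq | r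
var-shift θ k zero j nb r | true | _ with <ᵇ-sound k zero eq
... | ()
var-shift θ k (suc a) j nb r | true | rvar {x = y} res = rvar (rthere (nb y (here refl)) res)
var-shift θ k a j nb r | false | rvar {x = y} res = rvar (rthere (nb y (here refl)) res)

SubstitutesV : Ctx → Ctx → Ctx → ℕ → List (ℕ × DTerm) → (Sym → Term) → Term → Set
SubstitutesV V V' M' k σ σv a =
  ∀ x i j → x ∈ fv a → Res V x i j → Rep V' M' (downV k (substD (suc k) σ (v i j))) (σv x)

substVar-pat : ∀ {V' M'} k σ i j {b} θ' → NamesOut b θ' →
               Rep V' M' (downV k (substD (suc k) σ (v i j))) b →
               Rep V' (θ' ∷ M') (downV k (substD (suc k) (mapσ (upM 0) σ) (v i j))) b
substVar-pat {V'} {M'} k σ i j {b} θ' nb h with i ≡ᵇ suc k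
... | false = var-anyM k i j h
... | true rewrite lookup-lk (mapσ (upM 0) σ) j (v i j) | lk-map (upM 0) σ j =
  substituted (lk σ j) (subst (λ z → Rep V' M' (downV k z) b) (lookup-lk σ j (v i j)) h)
  where
    substituted : ∀ mu → Rep V' M' (downV k (fromMaybe (v i j) mu)) b →
                  Rep V' (θ' ∷ M') (downV k (fromMaybe (v i j) (Maybe.map (upM 0) mu))) b
    substituted nothing h' = var-anyM k i j h'
    substituted (just u) h' =
      subst (λ z → Rep V' (θ' ∷ M') z b) (sym (down-upM k 0 u)) (weakM [] 0 θ' (downV k u) refl nb h')

substVar-body : ∀ {V' M'} k σ i j {b} θ' → GapS k σ → NamesOut b θ' →
                Rep V' M' (downV k (substD (suc k) σ (v i j))) b →
                Rep (θ' ∷ V') M' (downV (suc k) (substD (suc (suc k)) (mapσ (upV 0) σ) (v (suc i) j))) b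
substVar-body {V'} {M'} k σ i j {b} θ' gs nb h with i ≡ᵇ suc k
... | false = var-shift θ' k i j nb h
... | true rewrite lookup-lk (mapσ (upV 0) σ) j (v (suc i) j) | lk-map (upV 0) σ j =
  substituted (lk σ j) (lk-gap σ j gs) (subst (λ z → Rep V' M' (downV k z) b) (lookup-lk σ j (v i j)) h)
  where
    substituted : ∀ mu → (∀ {u} → mu ≡ just u → Gap 0 (suc k) u) →
                  Rep V' M' (downV k (fromMaybe (v i j) mu)) b →
                  Rep (θ' ∷ V') M' (downV (suc k) (fromMaybe (v (suc i) j) (Maybe.map (upV 0) mu))) b
    substituted nothing _ h' = var-shift θ' k i j nb h'
    substituted (just u) g h' = weakV [] 0 k θ' u refl (g refl) nb h'

substitution : ∀ {V M V' M' t a} k σ σv σm → Rep V M t a → GapS k σ →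
               SubstitutesV V V' M' k σ σv a → RenamesM M M' σm a →
               Rep V' M' (downV k (substD (suc k) σ t)) (sub σv σm a)
substitution k σ σv σm (rvar {x = x} {i} {j} r) gs hv hm = hv x i j (here refl) r
substitution k σ σv σm (rmat {x = x} {i} {j} r) gs hv hm with hm x i j (here refl) r
... | y , e , r' = subst (Rep _ _ (m i j)) (sym e) (rmat r')
substitution k σ σv σm (rapp {a = a} r₁ r₂) gs hv hm =
  rapp (substitution k σ σv σm r₁ gs (λ x i j q → hv x i j (∈-++⁺ˡ q)) (λ x i j q → hm x i j (∈-++⁺ˡ q)))
       (substitution k σ σv σm r₂ gs (λ x i j q → hv x i j (∈-++⁺ʳ (fv a) q)) (λ x i j q → hm x i j (∈-++⁺ʳ (fm a) q)))
substitution {V} {M} {V'} {M'} k σ σv σm (rlam {θ = θ} {q = p} {r = s} le _ rp rs) gs hv hm =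
  rlam (trans (binder-len σv σm θ p s) le) (binder-unique σv σm θ p s)
       (substitution k (mapσ (upM 0) σ) σv (ext mat σm θ θ') rp (gapS-upM σ gs) hvp
          (renamesM-under σv σm θ p s hm))
       (substitution (suc k) (mapσ (upV 0) σ) (ext var σv θ θ') σm rs (gapS-upV σ gs) hvs
          (λ x i j q → hm x i j (∈-++⁺ʳ (filterᵇ (λ x → not (elem x θ)) (fm p)) q)))
  where
    θ' = binder σv σm θ p s
    hvp : SubstitutesV V V' (θ' ∷ M') k (mapσ (upM 0) σ) σv p
    hvp x i j q r = substVar-pat k σ i j θ' (binder-avoids-v σv σm θ p s (∈-++⁺ˡ q)) (hv x i j (∈-++⁺ˡ q) r)
    hvs : SubstitutesV (θ ∷ V) (θ' ∷ V') M' (suc k) (mapσ (upV 0) σ) (ext var σv θ θ') s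
    hvs x .1 j _ (rhere ps) rewrite ext-pos var σv θ θ' ps (sym (binder-len σv σm θ p s)) =
      rvar (binder-level (binder-unique σv σm θ p s) (binder-len σv σm θ p s) ps)
    hvs x (suc i) j xin (rthere nin r) rewrite ext-∉ var σv θ θ' x nin =
      substVar-body k σ i j θ' gs (binder-avoids-v σv σm θ p s (fv-lam-body θ p s xin nin))
        (hv x i j (fv-lam-body θ p s xin nin) r)

-- Step 3: matching commutes with representation.

isDataD-up : ∀ k t → isDataD (upV k t) ≡ isDataD t
isDataD-up k (v i j) with k <ᵇ i
... | true = refl
... | false = refl
isDataD-up k (m i j) = refl
isDataD-up k (t ·ᵈ u) = isDataD-up k t
isDataD-up k (lamᵈ n p s) = refl

isMFD-up : ∀ k t → isMFD (upV k t) ≡ isMFD t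
isMFD-up k (v i j) with k <ᵇ i
... | true = refl
... | false = refl
isMFD-up k (m i j) = refl
isMFD-up k (t ·ᵈ u) = isDataD-up k t
isMFD-up k (lamᵈ n p s) = refl

isMD-up : ∀ a b k t → isMD a b (upV k t) ≡ isMD a b t
isMD-up a b k (v i j) with k <ᵇ i
... | true = refl
... | false = refl
isMD-up a b k (m i j) = refl
isMD-up a b k (t ·ᵈ u) = refl
isMD-up a b k (lamᵈ n p s) = refl

rep-isData : ∀ {V M t a} → Rep V M t a → isDataD t ≡ isData a
rep-isData (rvar _) = refl
rep-isData (rmat _) = refl
rep-isData (rapp r _) = rep-isData r
rep-isData (rlam _ _ _ _) = refl

rep-isMF : ∀ {V M t a} → Rep V M t a → isMFD t ≡ isMF a
rep-isMF (rvar _) = refl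
rep-isMF (rmat _) = refl
rep-isMF (rapp r _) = rep-isData r
rep-isMF (rlam _ _ _ _) = refl

isMD-isMat : ∀ {V M x i j tu u} → Res M x (suc i) j → Rep V M tu u → isMD (suc i) j tu ≡ isMat x u
isMD-isMat {x = x} {i} {j} r (rmat {x = y} {i'} {j'} r') = bool-ext _ _ same-index same-name
  where
    same-index : ((suc i ≡ᵇ i') ∧ (j ≡ᵇ j')) ≡ true → (x ≡ᵇ y) ≡ true
    same-index e with ≡ᵇ-sound (suc i) i' (∧-l _ _ e) | ≡ᵇ-sound j j' (∧-r (suc i ≡ᵇ i') _ e)
    ... | refl | refl rewrite res-inj r r' = ≡ᵇ-refl y
    same-name : (x ≡ᵇ y) ≡ true → ((suc i ≡ᵇ i') ∧ (j ≡ᵇ j')) ≡ true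
    same-name e with ≡ᵇ-sound x y e
    ... | refl with res-fun r r'
    ... | refl , refl = ∧-intro (≡ᵇ-refl i) (≡ᵇ-refl j)
isMD-isMat r (rvar _) = refl
isMD-isMat r (rapp _ _) = refl
isMD-isMat r (rlam _ _ _ _) = refl

data SubstRel (θ : List Sym) (V M : Ctx) : List (ℕ × DTerm) → List (Sym × Term) → Set where
  [] : SubstRel θ V M [] []
  cons : ∀ {j x d e σ τ} → InRange θ j → x ≡ nth θ j → Rep V M d e → SubstRel θ V M σ τ →
         SubstRel θ V M ((j , upV 0 d) ∷ σ) ((x , e) ∷ τ)

data MatchRel (θ : List Sym) (V M : Ctx) : Match DTerm → Match Term → Set where
  fails : MatchRel θ V M fail fail
  waits : MatchRel θ V M wait wait
  succeeds : ∀ {σ τ} → SubstRel θ V M σ τ → MatchRel θ V M (ok σ) (ok τ)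

keys : ∀ {A : Set} → List (ℕ × A) → List ℕ
keys = map proj₁

keys-range : ∀ {θ V M σ τ} → SubstRel θ V M σ τ → ∀ {j} → j ∈ keys σ → InRange θ j
keys-range (cons ir _ _ _) (here refl) = ir
keys-range (cons _ _ _ sr) (there q) = keys-range sr q

keys-to : ∀ {θ V M σ τ} → SubstRel θ V M σ τ → ∀ {j} → j ∈ keys σ → nth θ j ∈ keys τ
keys-to (cons _ refl _ _) (here refl) = here refl
keys-to (cons _ _ _ sr) (there q) = there (keys-to sr q)

keys-from : ∀ {θ V M σ τ} → SubstRel θ V M σ τ → ∀ {x} → x ∈ keys τ →
            Σ ℕ λ j → (j ∈ keys σ) × (x ≡ nth θ j)
keys-from (cons {j = j} _ eq _ _) (here refl) = j , here refl , eq
keys-from (cons _ _ _ sr) (there q) with keys-from sr q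
... | j , q' , eq = j , there q' , eq

substRel-++ : ∀ {θ V M σ τ σ' τ'} → SubstRel θ V M σ τ → SubstRel θ V M σ' τ' →
              SubstRel θ V M (σ ++ σ') (τ ++ τ')
substRel-++ [] sr' = sr'
substRel-++ (cons ir eq r sr) sr' = cons ir eq r (substRel-++ sr sr')

substRel-gap : ∀ {θ V M σ τ} → SubstRel θ V M σ τ → GapS 0 σ
substRel-gap [] = []
substRel-gap (cons {d = d} _ _ _ sr) = gapUp 0 0 d (gap0 0 d) ∷ substRel-gap sr

disjoint-agree : ∀ {θ V M σ τ σ' τ'} → Unique θ → SubstRel θ V M σ τ → SubstRel θ V M σ' τ' →
                 disjoint σ σ' ≡ disjoint τ τ'
disjoint-agree {θ} {σ = σ} {τ} {σ'} {τ'} u sr sr' = cong not (bool-ext _ _ overlapN overlapD)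
  where
    overlapN : any (λ k → elem k (keys σ')) (keys σ) ≡ true → any (λ k → elem k (keys τ')) (keys τ) ≡ true
    overlapN e with any-true⁻ (λ k → elem k (keys σ')) (keys σ) e
    ... | j , q , e' =
      any-true⁺ _ (keys τ) (nth θ j) (keys-to sr q) (elem-complete (keys-to sr' (elem-sound j (keys σ') e')))
    overlapD : any (λ k → elem k (keys τ')) (keys τ) ≡ true → any (λ k → elem k (keys σ')) (keys σ) ≡ true
    overlapD e with any-true⁻ (λ k → elem k (keys τ')) (keys τ) e
    ... | x , q , e' with keys-from sr q | keys-from sr' (elem-sound x (keys τ') e')
    ... | j , qj , refl | j' , qj' , eq' =
      any-true⁺ _ (keys σ) j qj
        (elem-complete (subst (_∈ keys σ') (sym (nth-inj u (keys-range sr qj) (keys-range sr' qj') eq')) qj'))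

⊎-related : ∀ {θ V M r rN r' rN'} → Unique θ → MatchRel θ V M r rN → MatchRel θ V M r' rN' →
            MatchRel θ V M (r ⊎M r') (rN ⊎M rN')
⊎-related _ fails _ = fails
⊎-related _ waits fails = fails
⊎-related _ waits waits = waits
⊎-related _ waits (succeeds _) = waits
⊎-related _ (succeeds _) fails = fails
⊎-related _ (succeeds _) waits = waits
⊎-related u (succeeds {σ} {τ} sr) (succeeds {σ'} {τ'} sr') rewrite disjoint-agree u sr sr' with disjoint τ τ'
... | true = succeeds (substRel-++ sr sr')
... | false = fails

fail-or-wait : ∀ {θ V M} b → MatchRel θ V M (if b then fail else wait) (if b then fail else wait)
fail-or-wait true = fails
fail-or-wait false = waits

same-or-fail-or-wait : ∀ {θ V M} b c → MatchRel θ V M (if b then ok [] else (if c then fail else wait))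
                                                      (if b then ok [] else (if c then fail else wait))
same-or-fail-or-wait true c = succeeds []
same-or-fail-or-wait false c = fail-or-wait c

matching : ∀ {V M θ n tp p tu u} → Unique θ → Rep V (θ ∷ M) tp p → Rep V M tu u →
           MatchRel θ V M (matchD n tp (upV 0 tu)) (match θ p u)
matching _ (rvar _) _ = waits
matching {tu = tu} _ (rmat (rhere ps)) ru rewrite elem-complete (pos-∈ ps) =
  succeeds (cons (pos-range ps) (sym (pos-nth ps)) ru [])
matching {θ = θ} {tu = tu} {u} _ (rmat (rthere {x = x} {i = suc i} {j} nin r)) ru
  rewrite elem-∉ x θ nin | isMD-up (suc i) j 0 tu | isMFD-up 0 tu | rep-isMF ru | isMD-isMat r ru
  = same-or-fail-or-wait (isMat x u) (isMF u)
matching {n = n} {tu = tu₁ ·ᵈ tu₂} d (rapp {a = p₁} rp₁ rp₂) (rapp {a = u₁} ru₁ ru₂)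
  rewrite isDataD-up 0 tu₁ | rep-isData rp₁ | rep-isData ru₁ with isData p₁ ∧ isData u₁
... | true = ⊎-related d (matching {n = n} d rp₁ ru₁) (matching {n = n} d rp₂ ru₂)
... | false = waits
matching {tu = v i _} _ (rapp {a = p₁} rp₁ _) (rvar _) with 0 <ᵇ i
... | true rewrite rep-isData rp₁ = fail-or-wait (isData p₁ ∧ false)
... | false rewrite rep-isData rp₁ = fail-or-wait (isData p₁ ∧ false)
matching _ (rapp {a = p₁} rp₁ _) (rmat _) rewrite rep-isData rp₁ = fail-or-wait (isData p₁ ∧ true)
matching _ (rapp {a = p₁} rp₁ _) (rlam _ _ _ _) rewrite rep-isData rp₁ = fail-or-wait (isData p₁ ∧ true)
matching {tu = tu} {u} _ (rlam _ _ _ _) ru rewrite isMFD-up 0 tu | rep-isMF ru = fail-or-wait (isMF u)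

oneTo-∈ : ∀ {L j} → 1 ≤ j → j ≤ L → j ∈ oneTo L
oneTo-∈ {L} {suc j} _ le = ∈-map⁺ suc (∈-upTo⁺ le)

oneTo-∈⁻ : ∀ {θ j} → j ∈ oneTo (length θ) → InRange θ j
oneTo-∈⁻ q with ∈-map⁻ suc q
... | _ , q' , refl = s≤s z≤n , ∈-upTo⁻ q'

domain-agree : ∀ {θ V M σ τ} → Unique θ → SubstRel θ V M σ τ →
               setEq (keys σ) (oneTo (length θ)) ≡ setEq (keys τ) θ
domain-agree {θ} {σ = σ} {τ} u sr = cong₂ _∧_ (trans inRangeD (sym inθ)) (bool-ext _ _ coverN coverD)
  where
    inRangeD : all (λ x → elem x (oneTo (length θ))) (keys σ) ≡ true
    inRangeD = all-true⁺ _ (keys σ) λ j q → let (a , b) = keys-range sr q in elem-complete (oneTo-∈ a b)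
    inθ : all (λ x → elem x θ) (keys τ) ≡ true
    inθ = all-true⁺ _ (keys τ) λ x q → let (j , qj , eq) = keys-from sr q in
            elem-complete (subst (_∈ θ) (sym eq) (nth-∈ u (keys-range sr qj)))
    coverN : all (λ x → elem x (keys σ)) (oneTo (length θ)) ≡ true → all (λ x → elem x (keys τ)) θ ≡ true
    coverN e = all-true⁺ _ θ λ x q → let (j , ps) = pos-of q in
      let jin = elem-sound _ (keys σ) (all-true⁻ _ (oneTo (length θ)) e j (oneTo-∈ (pos-≥1 ps) (pos-≤len ps))) in
      elem-complete (subst (_∈ keys τ) (pos-nth ps) (keys-to sr jin))
    coverD : all (λ x → elem x (keys τ)) θ ≡ true → all (λ x → elem x (keys σ)) (oneTo (length θ)) ≡ true
    coverD e = all-true⁺ _ (oneTo (length θ)) λ j q → let ir = oneTo-∈⁻ {θ} q in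
      let (j' , qj' , eq) = keys-from sr (elem-sound _ (keys τ) (all-true⁻ _ θ e (nth θ j) (nth-∈ u ir))) in
      elem-complete (subst (_∈ keys σ) (sym (nth-inj u ir (keys-range sr qj') eq)) qj')

checkDom-ok : ∀ {θ V M r rN σ} → Unique θ → MatchRel θ V M r rN →
              checkDom (oneTo (length θ)) r ≡ ok σ →
              Σ (List (Sym × Term)) λ τ → (checkDom θ rN ≡ ok τ) × SubstRel θ V M σ τ ×
                                          (∀ {j} → InRange θ j → j ∈ keys σ)
checkDom-ok {θ} u (succeeds {σ₀} {τ₀} sr) eq with setEq (keys σ₀) (oneTo (length θ)) in e
checkDom-ok {θ} {σ = σ} u (succeeds {σ₀} {τ₀} sr) refl | true rewrite trans (sym (domain-agree u sr)) e =
  τ₀ , refl , sr , covered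
  where
    covered : ∀ {j} → InRange θ j → j ∈ keys σ₀
    covered (a , b) = elem-sound _ (keys σ₀) (all-true⁻ _ (oneTo (length θ)) (∧-r _ _ e) _ (oneTo-∈ a b))

checkDom-fail : ∀ {θ V M r rN} → Unique θ → MatchRel θ V M r rN →
                checkDom (oneTo (length θ)) r ≡ fail → checkDom θ rN ≡ fail
checkDom-fail u fails _ = refl
checkDom-fail {θ} u (succeeds {σ₀} sr) eq with setEq (keys σ₀) (oneTo (length θ)) in e
checkDom-fail {θ} u (succeeds {σ₀} sr) () | true
checkDom-fail {θ} u (succeeds {σ₀} sr) eq | false rewrite trans (sym (domain-agree u sr)) e = refl

lookup-related : ∀ {θ V M σ τ} → Unique θ → SubstRel θ V M σ τ → ∀ {j} → j ∈ keys σ →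
                 Σ DTerm λ d → Σ Term λ e → (∀ D → lookupσ σ j D ≡ upV 0 d) ×
                 (∀ E → lookupσ τ (nth θ j) E ≡ e) × Rep V M d e
lookup-related {θ} u (cons {j = j₀} {d = d₀} {e = e₀} {σ} {τ} ir₀ refl rd sr) {j} q with j₀ ≟ j | q
... | yes refl | _ =
  d₀ , e₀ , (λ D → cong (λ z → if z then upV 0 d₀ else lookupσ σ j₀ D) (≡ᵇ-refl j₀)) ,
  (λ E → cong (λ z → if z then e₀ else lookupσ τ (nth θ j₀) E) (≡ᵇ-refl (nth θ j₀))) , rd
... | no ne | here e = ⊥-elim (ne (sym e))
... | no ne | there q' with lookup-related u sr q'
... | d , e , fD , fN , r =
  d , e , (λ D → trans (cong (λ z → if z then upV 0 d₀ else lookupσ σ j D) (≢⇒≡ᵇ-false j₀ j ne)) (fD D)) ,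
  (λ E → trans (cong (λ z → if z then e₀ else lookupσ τ (nth θ j) E)
                 (≢⇒≡ᵇ-false (nth θ j₀) (nth θ j) (λ eq → ne (nth-inj u ir₀ (keys-range sr q') eq)))) (fN E)) , r

lookup-outside : ∀ {θ V M σ τ} → Unique θ → SubstRel θ V M σ τ → ∀ {x} → x ∉ θ → ∀ E → lookupσ τ x E ≡ E
lookup-outside u [] nin E = refl
lookup-outside {θ} u (cons {j = j₀} ir₀ refl _ sr) {x} nin E
  rewrite ≢⇒≡ᵇ-false (nth θ j₀) x (λ eq → nin (subst (_∈ θ) eq (nth-∈ u ir₀))) = lookup-outside u sr nin E

-- Step 4: simulation of one dB step by one PPC step on the representative.

match-substitutes : ∀ {θ V M σ τ} s → Unique θ → SubstRel θ V M σ τ →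
                    (∀ {j} → InRange θ j → j ∈ keys σ) → SubstitutesV (θ ∷ V) V M 0 σ (env τ) s
match-substitutes {θ} {σ = σ} {τ} s u sr covered x .1 j _ (rhere ps)
  with lookup-related u sr (covered (pos-range ps))
... | d , e , fD , fN , r rewrite fD (v 1 j) | down-up 0 d | sym (pos-nth ps) | fN (var (nth θ j)) = r
match-substitutes s u sr covered x (suc (suc i)) j _ (rthere nin r)
  rewrite lookup-outside u sr nin (var x) = rvar r

β-ok-simulation : ∀ {V M θ tp ts tu p s u σ} → Unique θ →
                  Rep V (θ ∷ M) tp p → Rep (θ ∷ V) M ts s → Rep V M tu u →
                  checkDom (oneTo (length θ)) (matchD (length θ) tp (upV 0 tu)) ≡ ok σ →
                  Σ (List (Sym × Term)) λ τ → (checkDom θ (match θ p u) ≡ ok τ) ×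
                                              Rep V M (downV 0 (substD 1 σ ts)) (sub (env τ) mat s)
β-ok-simulation {θ = θ} {s = s} {σ = σ} u rp rs ru eq with checkDom-ok u (matching {n = length θ} u rp ru) eq
... | τ , eqN , sr , covered =
  τ , eqN , substitution 0 σ (env τ) mat rs (substRel-gap sr) (match-substitutes s u sr covered)
              (λ x i j _ r → x , refl , r)

failTerm-represents : ∀ {V M} → Rep V M (downV 0 failD) failTerm
failTerm-represents = rlam refl ([] ∷ []) (rmat (rhere phere)) (rvar (rhere phere))

simulate : ∀ {V M t t' a} → t ⟶dB t' → Rep V M t a → Σ Term λ b → (a ⟶₀ b) × Rep V M t' b
simulate (βok eq) (rapp (rlam refl u rp rs) ru) with β-ok-simulation u rp rs ru eq
... | τ , eqN , r = _ , βok eqN , r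
simulate (βfail eq) (rapp (rlam {θ = θ} refl u rp rs) ru) =
  failTerm , βfail (checkDom-fail u (matching {n = length θ} u rp ru) eq) , failTerm-represents
simulate (appL st) (rapp {b = b} r₁ r₂) with simulate st r₁
... | a' , st' , r' = a' · b , appL st' , rapp r' r₂
simulate (appR st) (rapp {a = a} r₁ r₂) with simulate st r₂
... | b' , st' , r' = a · b' , appR st' , rapp r₁ r'
simulate (lamP st) (rlam {θ = θ} {r = r} le u rp rs) with simulate st rp
... | q' , st' , r' = lam θ q' r , lamP st' , rlam le u r' rs
simulate (lamS st) (rlam {θ = θ} {q = q} le u rp rs) with simulate st rs
... | r' , st' , rr = lam θ q r' , lamS st' , rlam le u rp rr

-- Step 5: representatives of the same term are α-equivalent.

Compat : Ctx → Ctx → Set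
Compat V V' = ∀ {x y i j} → Res V x i j → Res V' y i j → x ≡ y

compat-cons : ∀ {V V'} z → Compat V V' → Compat (z ∷ V) (z ∷ V')
compat-cons z c (rhere p) (rhere q) = pos-inj p q
compat-cons z c (rthere _ r) (rthere _ s) = c r s

renM-represents : ∀ {V M θ z tp p} → Unique z → length θ ≡ length z → (∀ x → x ∈ fm p → x ∉ z) →
                  Rep V (θ ∷ M) tp p → Rep V (z ∷ M) tp (renM θ z p)
renM-represents {M = M} {θ} {z} {p = p} uz lz out rp = rename var (ext mat mat θ z) rp (λ x i j _ r → x , refl , r) renamed
  where
    renamed : RenamesM (θ ∷ M) (z ∷ M) (ext mat mat θ z) p
    renamed x .1 j _ (rhere ps) = nth z j , ext-pos mat mat θ z ps lz , binder-level uz (sym lz) ps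
    renamed x (suc i) j xin (rthere nin r) = x , ext-∉ mat mat θ z x nin , rthere (out x xin) r

renV-represents : ∀ {V M θ z ts s} → Unique z → length θ ≡ length z → (∀ x → x ∈ fv s → x ∉ z) →
                  Rep (θ ∷ V) M ts s → Rep (z ∷ V) M ts (renV θ z s)
renV-represents {V = V} {θ = θ} {z} {s = s} uz lz out rs = rename (ext var var θ z) mat rs renamed (λ x i j _ r → x , refl , r)
  where
    renamed : RenamesV (θ ∷ V) (z ∷ V) (ext var var θ z) s
    renamed x .1 j _ (rhere ps) = nth z j , ext-pos var var θ z ps lz , binder-level uz (sym lz) ps
    renamed x (suc i) j xin (rthere nin r) = x , ext-∉ var var θ z x nin , rthere (out x xin) r

represent-α : ∀ {V M V' M' t a b} → Rep V M t a → Rep V' M' t b → Compat V V' → Compat M M' → a ≈α b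
represent-α (rvar r) (rvar r') cv cm with cv r r'
... | refl = var
represent-α (rmat r) (rmat r') cv cm with cm r r'
... | refl = mat
represent-α (rapp r₁ r₂) (rapp r₁' r₂') cv cm = app (represent-α r₁ r₁' cv cm) (represent-α r₂ r₂' cv cm)
represent-α (rlam {θ = θ} {q = p} {r = s} le _ rp rs) (rlam {θ = θ'} {q = p'} {r = s'} le' _ rp' rs') cv cm =
  lam (trans le (sym le'))
    (represent-α (renM-represents uz (sym lz) (λ x q → fresh-∉ (length θ) L (inLeft (∈-++⁺ˡ (fm-names p q)))) rp)
                 (renM-represents uz lz' (λ x q → fresh-∉ (length θ) L (inRight (∈-++⁺ˡ (fm-names p' q)))) rp')
                 cv (compat-cons z cm))
    (represent-α (renV-represents uz (sym lz) (λ x q → fresh-∉ (length θ) L (inLeft (∈-++⁺ʳ (names p) (fv-names s q)))) rs)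
                 (renV-represents uz lz' (λ x q → fresh-∉ (length θ) L (inRight (∈-++⁺ʳ (names p') (fv-names s' q)))) rs')
                 (compat-cons z cv) cm)
  where
    L = names (lam θ p s) ++ names (lam θ' p' s')
    z = fresh (length θ) L
    lz : length z ≡ length θ
    lz = fresh-len (length θ) L
    lz' : length θ' ≡ length z
    lz' = trans (trans le' (sym le)) (sym lz)
    uz = fresh-unique (length θ) L
    inLeft : ∀ {x} → x ∈ names p ++ names s → x ∈ L
    inLeft q = ∈-++⁺ˡ (∈-++⁺ʳ θ q)
    inRight : ∀ {x} → x ∈ names p' ++ names s' → x ∈ L
    inRight q = ∈-++⁺ʳ (names (lam θ p s)) (∈-++⁺ʳ θ' q)

sing : Sym → List Sym
sing k = k ∷ []

initCtx : (ℕ → Sym) → ℕ → Ctx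
initCtx f N = map sing (applyUpTo f N)

init-resolves⁻ : ∀ f N {x i j} → Res (initCtx f N) x i j → (x ≡ f (i ∸ 1)) × (j ≡ 1)
init-resolves⁻ f (suc N) (rhere phere) = refl , refl
init-resolves⁻ f (suc N) (rthere {i = suc i} _ r) = init-resolves⁻ (λ z → f (suc z)) N r

init-resolves : ∀ f → (∀ {a b} → f a ≡ f b → a ≡ b) → ∀ N i → 1 ≤ i → i ≤ N →
                Res (initCtx f N) (f (i ∸ 1)) i 1
init-resolves f inj (suc N) (suc zero) _ _ = rhere phere
init-resolves f inj (suc N) (suc (suc i)) _ (s≤s le) =
  rthere (λ { (here e) → zero≢suc (inj e) })
         (init-resolves (λ z → f (suc z)) (λ e → suc-injective (inj e)) N (suc i) (s≤s z≤n) le)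
  where
    zero≢suc : ∀ {k} → suc k ≢ 0
    zero≢suc ()

init-look : ∀ f N i → 1 ≤ i → i ≤ N → look (initCtx f N) i 1 ≡ f (i ∸ 1)
init-look f (suc N) (suc zero) _ _ = refl
init-look f (suc N) (suc (suc i)) _ (s≤s le) = init-look (λ z → f (suc z)) N (suc i) (s≤s z≤n) le

ctxU : DTerm → Ctx
ctxU t = initCtx (λ k → k) (maxL (map proj₁ (fvD t ++ fmD t)))

init-compat : ∀ N N' → Compat (initCtx (λ k → k) N) (initCtx (λ k → k) N')
init-compat N N' r r' = trans (proj₁ (init-resolves⁻ _ N r)) (sym (proj₁ (init-resolves⁻ _ N' r')))

U-represents : ∀ t → Idx t → WF t → Rep (ctxU t) (ctxU t) t (U t)
U-represents t idx (secondary1 , loc) =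
  UE-represents X X t idx loc
    (λ q → resolves (∈-++⁺ˡ q) (proj₁ (idx-fv t idx q)))
    (λ q → resolves (∈-++⁺ʳ (fvD t) q) (proj₁ (idx-fm t idx q)))
  where
    N = maxL (map proj₁ (fvD t ++ fmD t))
    X = ctxU t
    resolves : ∀ {i j} → (i , j) ∈ fvD t ++ fmD t → 1 ≤ i → Resolves X (i , j)
    resolves {i} q i≥1 with secondary1 q
    ... | refl = subst (λ y → Res X y i 1) (sym (init-look (λ k → k) N i i≥1 le)) (init-resolves (λ k → k) (λ e → e) N i i≥1 le)
      where le = maxL-≤ (∈-map⁺ proj₁ q)

initial-WF : ∀ {N t b} → Rep (initCtx (λ k → k) N) (initCtx (λ k → k) N) t b → WF t
initial-WF {N} {t} r = secondary1 , rep-loc r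
  where
    secondary1 : ∀ {i j} → (i , j) ∈ fvD t ++ fmD t → j ≡ 1
    secondary1 q with ∈-++⁻ (fvD t) q
    ... | inj₁ q' = proj₂ (init-resolves⁻ _ N (proj₂ (rep-fv r q')))
    ... | inj₂ q' = proj₂ (init-resolves⁻ _ N (proj₂ (rep-fm r q')))

theorem5p5 : ∀ (t t' : DTerm) → Idx t → WF t → t ⟶dB t' → U t ⟶PPC U t'
theorem5p5 t t' idx wf step with simulate step (U-represents t idx wf)
... | b , Ut⟶b , rb =
  U t , b , represent-α rt rt (init-compat _ _) (init-compat _ _) , Ut⟶b ,
  represent-α rb (U-represents t' (rep-idx rb) (initial-WF rb)) (init-compat _ _) (init-compat _ _)
  where
    rt = U-represents t idx wf
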